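{- For odd $k$ let $\mathrm{Ex}^{(k+1)/2}_k=f_{\{(k+1)/2\},k}:\{ -1,1\}^k\to\{0,1\}$ be the function which is $1$ exactly on vectors with exactly $\frac{k+1}2$ coordinates equal to $1$, and let $\rho\big(\mathrm{Ex}^{(k+1)/2}_k\big)=\Pr_{\mathbf b\sim\mathrm{Unif}(\{ -1,1\}^k)}\big[\mathrm{Ex}^{(k+1)/2}_k(\mathbf b)=1\big]$. Then, with the limit taken over odd $k$, $$\lim_{k\text{ odd},\,k\to\infty}\frac{\alpha\big(\mathrm{Ex}^{(k+1)/2}_k\big)}{\rho\big(\mathrm{Ex}^{(k+1)/2}_k\big)}=1.$$
   Context: For $\mathbf b\in\{ -1,1\}^k$, $\mathrm{wt}(\mathbf b)$ is the number of coordinates equal to $1$. For nonempty $S\subseteq[k]=\{1,\dots,k\}$, $f_{S,k}:\{ -1,1\}^k\to\{0,1\}$ is given by $f_{S,k}(\mathbf x)=1$ iff $\mathrm{wt}(\mathbf x)\in S$. $\Delta_k$ is the set of symmetric probability distributions $\mathcal D$ on $\{ -1,1\}^k$ (vectors of equal weight are equiprobable). $\mathrm{Bern}(p)$ is the random variable equal to $1$ with probability $p$ and $-1$ with probability $1-p$; $\odot$ is the coordinatewise product. For $\mathcal D\in\Delta_k$ and $p\in[0,1]$ define $$\lambda_S(\mathcal D,p)=\mathbb E_{\mathbf a\sim\mathcal D,\ \mathbf b\sim \mathrm{Bern}(p)^k}[f_{S,k}(\mathbf a\odot\mathbf b)],\quad \mu(\mathcal D)=\mathbb E_{\mathbf b\sim\mathcal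 D}[b_1],\quad \beta_S(\mathcal D)=\sup_{p\in[0,1]}\lambda_S(\mathcal D,p),\quad \gamma_S(\mathcal D)=\lambda_S(\mathcal D,1).$$ The (sketching approximation) ratio of $f_{S,k}$ is $$\alpha(f_{S,k})=\inf_{\mathcal D_N,\mathcal D_Y\in\Delta_k:\ \mu(\mathcal D_N)=\mu(\mathcal D_Y)}\frac{\beta_S(\mathcal D_N)}{\gamma_S(\mathcal D_Y)},$$ where the ratio is $+\infty$ if $\gamma_S(\mathcal D_Y)=0$. -}

module Defs where

open import Level using (Level; suc)
open import Algebra.Bundles using (CommutativeRing)
import Algebra.Construct.NaturalChoice.Max as Max
import Algebra.Properties.Monoid.Mult as Mult
import Algebra.Properties.Ring as RingProperties
import Algebra.Properties.Semiring.Exp as Exp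
open import Data.Bool.Base using (Bool; true; false; if_then_else_)
open import Data.Empty using (⊥-elim)
open import Data.Fin.Base using (Fin; toℕ; fromℕ<)
open import Data.Fin.Properties using (any?; toℕ<n)
open import Data.Fin.Subset using (Subset; ⁅_⁆; Nonempty; _∈_)
open import Data.Fin.Subset.Properties using (_∈?_; x∈⁅x⁆)
import Data.Nat.Base as ℕ
open ℕ using (ℕ; zero; z≤n; s≤s)
import Data.Nat.Properties as ℕ
open import Data.Product.Base using (Σ; ∃; _×_; _,_; proj₁; proj₂)
import Data.Sign.Base as Sign
open Sign using (Sign)
import Data.Sign.Properties as Sign
open import Data.Sum.Base using (inj₁; inj₂)
open import Data.Vec.Base using (Vec; []; _∷_; head; count; zipWith; replicate)
open import Function.Base using (_∘_)
open import Relation.Binary.Bundles using (DecTotalOrder)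
open import Relation.Binary.Core using (Rel)
import Relation.Binary.Construct.Add.Supremum.NonStrict as AddSup
import Relation.Binary.Construct.NonStrictToStrict as ToStrict
open import Relation.Binary.PropositionalEquality as ≡ using (_≡_)
import Relation.Binary.Reasoning.PartialOrder as ≤-Reasoning
open import Relation.Binary.Structures using (IsDecTotalOrder)
open import Relation.Nullary.Construct.Add.Supremum using (_⁺; ⊤⁺; [_])
open import Relation.Nullary.Decidable
  using (Dec; yes; no; does; _×-dec_; dec-true; dec-false)
open import Relation.Nullary.Negation.Core using (¬_)

private
  variable
    a ℓ ℓ′ : Level

IsSupremum : {A : Set a} → Rel A ℓ → {I : Set ℓ′} → (I → A) → A → Set _
IsSupremum _≤_ f s = (∀ i → f i ≤ s) × (∀ u → (∀ i → f i ≤ u) → s ≤ u)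

IsInfimum : {A : Set a} → Rel A ℓ → {I : Set ℓ′} → (I → A) → A → Set _
IsInfimum _≤_ f s = (∀ i → s ≤ f i) × (∀ l → (∀ i → l ≤ f i) → l ≤ s)

-- The real numbers, axiomatised as a Dedekind-complete ordered field.
-- Classically these axioms determine ℝ up to isomorphism.  The value 0# ⁻¹
-- is left unspecified.  `archimedean` follows from `complete` classically,
-- but not constructively, so it is listed separately.
record CompleteOrderedField ℓ : Set (suc ℓ) where
  field
    commutativeRing : CommutativeRing ℓ ℓ

  open CommutativeRing commutativeRing public hiding (zero)
  open Mult +-monoid public using () renaming (_×_ to _·_)

  infix 4 _≤_
  infix 8 _⁻¹

  field
    _≤_             : Rel Carrier ℓ
    _⁻¹             : Carrier → Carrier
    isDecTotalOrder : IsDecTotalOrder _≈_ _≤_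
    0≉1             : ¬ 0# ≈ 1#
    *-inverseʳ      : ∀ {x} → ¬ x ≈ 0# → x * x ⁻¹ ≈ 1#
    +-monoˡ-≤       : ∀ {x y} z → x ≤ y → x + z ≤ y + z
    *-nonneg        : ∀ {x y} → 0# ≤ x → 0# ≤ y → 0# ≤ x * y
    archimedean     : ∀ x → ∃ λ n → x ≤ n · 1#
    complete        : {I : Set ℓ} (f : I → Carrier) → I →
                      (∃ λ b → ∀ i → f i ≤ b) → ∃ (IsSupremum _≤_ f)

  decTotalOrder : DecTotalOrder ℓ ℓ ℓ
  decTotalOrder = record { isDecTotalOrder = isDecTotalOrder }

  open DecTotalOrder decTotalOrder public
    using (_≟_; _≤?_; totalOrder; poset; ≤-respˡ-≈; ≤-respʳ-≈)
    renaming ( refl to ≤-refl; trans to ≤-trans; antisym to ≤-antisym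
             ; total to ≤-total )
  open ToStrict _≈_ _≤_ public using (_<_)
  open AddSup _≤_ public using (_≤⁺_; _≤⊤⁺; [_])
  open Max totalOrder public using (_⊔_)
  open Exp semiring public using (_^_)

  infixl 7 _/_

  _/_ : Carrier → Carrier → Carrier
  x / y = x * y ⁻¹

  ∣_∣ : Carrier → Carrier
  ∣ x ∣ = x ⊔ (- x)

  UnitInterval : Set ℓ
  UnitInterval = Σ Carrier λ p → 0# ≤ p × p ≤ 1#

module OrderedFieldProperties {ℓ} (R : CompleteOrderedField ℓ) where
  open CompleteOrderedField R
  open RingProperties ring
  open ≤-Reasoning poset

  +-monoʳ-≤ : ∀ {x y} z → x ≤ y → z + x ≤ z + y
  +-monoʳ-≤ {x} {y} z x≤y = begin
    z + x  ≈⟨ +-comm z x ⟩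
    x + z  ≤⟨ +-monoˡ-≤ z x≤y ⟩
    y + z  ≈⟨ +-comm y z ⟩
    z + y  ∎

  +-mono-≤ : ∀ {x y u v} → x ≤ y → u ≤ v → x + u ≤ y + v
  +-mono-≤ x≤y u≤v = ≤-trans (+-monoˡ-≤ _ x≤y) (+-monoʳ-≤ _ u≤v)

  +-nonneg : ∀ {x y} → 0# ≤ x → 0# ≤ y → 0# ≤ x + y
  +-nonneg 0≤x 0≤y = ≤-respˡ-≈ (+-identityˡ 0#) (+-mono-≤ 0≤x 0≤y)

  x≤y⇒0≤y-x : ∀ {x y} → x ≤ y → 0# ≤ y - x
  x≤y⇒0≤y-x {x} x≤y = ≤-respˡ-≈ (-‿inverseʳ x) (+-monoˡ-≤ (- x) x≤y)

  0≤y-x⇒x≤y : ∀ {x y} → 0# ≤ y - x → x ≤ y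
  0≤y-x⇒x≤y {x} {y} 0≤y-x = begin
    x                ≈⟨ +-identityˡ x ⟨
    0# + x           ≤⟨ +-monoˡ-≤ x 0≤y-x ⟩
    y - x + x        ≈⟨ +-assoc y (- x) x ⟩
    y + (- x + x)    ≈⟨ +-congˡ (-‿inverseˡ x) ⟩
    y + 0#           ≈⟨ +-identityʳ y ⟩
    y                ∎

  neg-anti-≤ : ∀ {x y} → x ≤ y → - y ≤ - x
  neg-anti-≤ {x} {y} x≤y = 0≤y-x⇒x≤y (≤-respʳ-≈ eq (x≤y⇒0≤y-x x≤y))
    where
    eq : y - x ≈ - x - - y
    eq = trans (+-comm y (- x)) (+-congˡ (sym (-‿involutive y)))

  neg-swapˡ-≤ : ∀ {x y} → - x ≤ y → - y ≤ x
  neg-swapˡ-≤ -x≤y = ≤-respʳ-≈ (-‿involutive _) (neg-anti-≤ -x≤y)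

  neg-swapʳ-≤ : ∀ {x y} → x ≤ - y → y ≤ - x
  neg-swapʳ-≤ x≤-y = ≤-respˡ-≈ (-‿involutive _) (neg-anti-≤ x≤-y)

  *-monoˡ-≤ : ∀ {x y z} → 0# ≤ z → x ≤ y → z * x ≤ z * y
  *-monoˡ-≤ {x} {y} {z} 0≤z x≤y = 0≤y-x⇒x≤y
    (≤-respʳ-≈ (x[y-z]≈xy-xz z y x) (*-nonneg 0≤z (x≤y⇒0≤y-x x≤y)))

  0≤1 : 0# ≤ 1#
  0≤1 with ≤-total 0# 1#
  ... | inj₁ 0≤1  = 0≤1
  ... | inj₂ 1≤0# = ≤-respʳ-≈ eq (*-nonneg 0≤-1 0≤-1)
    where
    0≤-1 : 0# ≤ - 1#
    0≤-1 = ≤-respˡ-≈ -0#≈0# (neg-anti-≤ 1≤0#)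
    eq : - 1# * - 1# ≈ 1#
    eq = trans (-1*x≈-x (- 1#)) (-‿involutive 1#)

  ⁻¹-nonneg : ∀ {x} → ¬ x ≈ 0# → 0# ≤ x → 0# ≤ x ⁻¹
  ⁻¹-nonneg {x} x≉0 0≤x with ≤-total 0# (x ⁻¹)
  ... | inj₁ 0≤x⁻¹ = 0≤x⁻¹
  ... | inj₂ x⁻¹≤0 = ⊥-elim (0≉1 (≤-antisym 0≤1 1≤0))
    where
    1≤0 : 1# ≤ 0#
    1≤0 = begin
      1#        ≈⟨ *-inverseʳ x≉0 ⟨
      x * x ⁻¹  ≤⟨ *-monoˡ-≤ 0≤x x⁻¹≤0 ⟩
      x * 0#    ≈⟨ zeroʳ x ⟩
      0#        ∎

  complete-inf : {I : Set ℓ} (f : I → Carrier) → I →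
                 (∃ λ b → ∀ i → b ≤ f i) → ∃ (IsInfimum _≤_ f)
  complete-inf f i₀ (b , b≤f) with complete (-_ ∘ f) i₀ (- b , neg-anti-≤ ∘ b≤f)
  ... | s , ub , least =
    - s , neg-swapˡ-≤ ∘ ub
        , λ l l≤f → neg-swapʳ-≤ (least (- l) (neg-anti-≤ ∘ l≤f))

  complete-inf⁺ : {I : Set ℓ} (f : I → Carrier ⁺) →
                  (∃ λ i → ∃ λ r → f i ≡ [ r ]) →
                  (∃ λ b → ∀ i → [ b ] ≤⁺ f i) →
                  ∃ λ m → IsInfimum _≤⁺_ f [ m ]
  complete-inf⁺ {I} f (i₀ , r₀ , fi₀≡r₀) (b , b≤f) =
    m , (λ i → lower (f i) ≡.refl) , greatest
    where
    unlift : ∀ {x y} → [ x ] ≤⁺ [ y ] → x ≤ y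
    unlift [ x≤y ] = x≤y

    finite : (∃ λ i → ∃ λ r → f i ≡ [ r ]) → Carrier
    finite (_ , r , _) = r

    inf : ∃ (IsInfimum _≤_ finite)
    inf = complete-inf finite (i₀ , r₀ , fi₀≡r₀)
      (b , λ (i , r , eq) → unlift (≡.subst ([ b ] ≤⁺_) eq (b≤f i)))

    m : Carrier
    m = proj₁ inf

    lower : ∀ {i} x → f i ≡ x → [ m ] ≤⁺ x
    lower     ⊤⁺    _  = [ m ] ≤⊤⁺
    lower {i} [ r ] eq = [ proj₁ (proj₂ inf) (i , r , eq) ]

    greatest : ∀ l → (∀ i → l ≤⁺ f i) → l ≤⁺ [ m ]
    greatest ⊤⁺    l≤f with () ← ≡.subst (⊤⁺ ≤⁺_) fi₀≡r₀ (l≤f i₀)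
    greatest [ l ] l≤f = [ proj₂ (proj₂ inf) l
      (λ (i , r , eq) → unlift (≡.subst ([ l ] ≤⁺_) eq (l≤f i))) ]

-- {-1,1}ᵏ is Vec Sign k.
wt : ∀ {k} → Vec Sign k → ℕ
wt = count (Sign._≟ Sign.+)

_⊙_ : ∀ {k} → Vec Sign k → Vec Sign k → Vec Sign k
_⊙_ = zipWith Sign._*_

-- A subset of [k] = {1,…,k} is a Subset k, where the index i : Fin k stands
-- for the number 1 + toℕ i.
infix 4 _∈[_]

_∈[_] : ℕ → ∀ {k} → Subset k → Set
w ∈[ S ] = ∃ λ i → i ∈ S × ℕ.suc (toℕ i) ≡ w

_∈[_]? : ∀ w {k} (S : Subset k) → Dec (w ∈[ S ])
w ∈[ S ]? = any? λ i → (i ∈? S) ×-dec (ℕ.suc (toℕ i) ℕ.≟ w)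

-- true is the value 1 of f_{S,k}; see `indicator` for the real-valued version.
f : ∀ {k} → Subset k → Vec Sign k → Bool
f S x = does (wt x ∈[ S ]?)

-- The set {m + 1} = {(k + 1)/2} for k = 2m + 1.
middle : ∀ m → Subset (ℕ.suc (2 ℕ.* m))
middle m = ⁅ fromℕ< (s≤s (ℕ.m≤m+n m (m ℕ.+ 0))) ⁆

middle-nonempty : ∀ m → Nonempty (middle m)
middle-nonempty m = _ , x∈⁅x⁆ _

module Sketching {ℓ} (R : CompleteOrderedField ℓ) where
  open CompleteOrderedField R
  open OrderedFieldProperties R
  open RingProperties ring
  open ≤-Reasoning poset

  ∑ : ∀ {k} → (Vec Sign k → Carrier) → Carrier
  ∑ {zero}    g = g []
  ∑ {ℕ.suc k} g = ∑ (g ∘ (Sign.+ ∷_)) + ∑ (g ∘ (Sign.- ∷_))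

  ∑-mono : ∀ {k} {g h : Vec Sign k → Carrier} → (∀ x → g x ≤ h x) → ∑ g ≤ ∑ h
  ∑-mono {zero}    g≤h = g≤h []
  ∑-mono {ℕ.suc k} g≤h = +-mono-≤ (∑-mono (g≤h ∘ (_ ∷_))) (∑-mono (g≤h ∘ (_ ∷_)))

  ∑-cong : ∀ {k} {g h : Vec Sign k → Carrier} → (∀ x → g x ≈ h x) → ∑ g ≈ ∑ h
  ∑-cong {zero}    g≈h = g≈h []
  ∑-cong {ℕ.suc k} g≈h = +-cong (∑-cong (g≈h ∘ (_ ∷_))) (∑-cong (g≈h ∘ (_ ∷_)))

  ∑-nonneg : ∀ {k} {g : Vec Sign k → Carrier} → (∀ x → 0# ≤ g x) → 0# ≤ ∑ g
  ∑-nonneg {zero}    0≤g = 0≤g []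
  ∑-nonneg {ℕ.suc k} 0≤g = +-nonneg (∑-nonneg (0≤g ∘ (_ ∷_))) (∑-nonneg (0≤g ∘ (_ ∷_)))

  ∑-*ˡ : ∀ {k} c (g : Vec Sign k → Carrier) → ∑ (λ x → c * g x) ≈ c * ∑ g
  ∑-*ˡ {zero}    c g = refl
  ∑-*ˡ {ℕ.suc k} c g = trans
    (+-cong (∑-*ˡ {k} c (g ∘ (_ ∷_))) (∑-*ˡ {k} c (g ∘ (_ ∷_))))
    (sym (distribˡ c _ _))

  term≤∑ : ∀ {k} {g : Vec Sign k → Carrier} → (∀ x → 0# ≤ g x) → ∀ x → g x ≤ ∑ g
  term≤∑ 0≤g []           = ≤-refl
  term≤∑ 0≤g (Sign.+ ∷ x) = ≤-respˡ-≈ (+-identityʳ _)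
    (+-mono-≤ (term≤∑ (0≤g ∘ (_ ∷_)) x) (∑-nonneg (0≤g ∘ (_ ∷_))))
  term≤∑ 0≤g (Sign.- ∷ x) = ≤-respˡ-≈ (+-identityˡ _)
    (+-mono-≤ (∑-nonneg (0≤g ∘ (_ ∷_))) (term≤∑ (0≤g ∘ (_ ∷_)) x))

  record Distribution (k : ℕ) : Set ℓ where
    field
      mass        : Vec Sign k → Carrier
      mass-nonneg : ∀ x → 0# ≤ mass x
      mass-total  : ∑ mass ≈ 1#

  open Distribution public

  Symmetric : ∀ {k} → Distribution k → Set ℓ
  Symmetric D = ∀ x y → wt x ≡ wt y → mass D x ≈ mass D y

  Δ : ℕ → Set ℓ
  Δ k = Σ (Distribution k) Symmetric

  𝔼 : ∀ {k} → Distribution k → (Vec Sign k → Carrier) → Carrier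
  𝔼 D g = ∑ λ x → mass D x * g x

  𝔼-nonneg : ∀ {k} (D : Distribution k) {g} → (∀ x → 0# ≤ g x) → 0# ≤ 𝔼 D g
  𝔼-nonneg D 0≤g = ∑-nonneg λ x → *-nonneg (mass-nonneg D x) (0≤g x)

  𝔼≤1 : ∀ {k} (D : Distribution k) {g} → (∀ x → g x ≤ 1#) → 𝔼 D g ≤ 1#
  𝔼≤1 D {g} g≤1 = begin
    ∑ (λ x → mass D x * g x)  ≤⟨ ∑-mono (λ x → *-monoˡ-≤ (mass-nonneg D x) (g≤1 x)) ⟩
    ∑ (λ x → mass D x * 1#)   ≈⟨ ∑-cong (λ x → *-identityʳ (mass D x)) ⟩
    ∑ (mass D)                ≈⟨ mass-total D ⟩
    1#                        ∎

  bernMass : ∀ {k} → Carrier → Vec Sign k → Carrier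
  bernMass p []           = 1#
  bernMass p (Sign.+ ∷ x) = p * bernMass p x
  bernMass p (Sign.- ∷ x) = (1# - p) * bernMass p x

  Bern : UnitInterval → ∀ k → Distribution k
  Bern (p , 0≤p , p≤1) k = record
    { mass        = bernMass p
    ; mass-nonneg = nonneg
    ; mass-total  = sum k
    }
    where
    nonneg : ∀ {k} (x : Vec Sign k) → 0# ≤ bernMass p x
    nonneg []           = 0≤1
    nonneg (Sign.+ ∷ x) = *-nonneg 0≤p (nonneg x)
    nonneg (Sign.- ∷ x) = *-nonneg (x≤y⇒0≤y-x p≤1) (nonneg x)

    p+[1-p]≈1 : p + (1# - p) ≈ 1#
    p+[1-p]≈1 = trans (+-comm p _) (trans (+-assoc 1# (- p) p)
      (trans (+-congˡ (-‿inverseˡ p)) (+-identityʳ 1#)))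

    sum : ∀ k → ∑ {k} (bernMass p) ≈ 1#
    sum zero      = refl
    sum (ℕ.suc k) = begin-equality
      ∑ {k} (λ x → p * bernMass p x) + ∑ {k} (λ x → (1# - p) * bernMass p x)
        ≈⟨ +-cong (∑-*ˡ {k} p (bernMass p)) (∑-*ˡ {k} (1# - p) (bernMass p)) ⟩
      p * ∑ {k} (bernMass p) + (1# - p) * ∑ {k} (bernMass p)
        ≈⟨ distribʳ _ p (1# - p) ⟨
      (p + (1# - p)) * ∑ {k} (bernMass p)  ≈⟨ *-cong p+[1-p]≈1 (sum k) ⟩
      1# * 1#                              ≈⟨ *-identityˡ 1# ⟩
      1#                                   ∎

  2# : Carrier
  2# = 1# + 1#

  0≤2^ : ∀ k → 0# ≤ 2# ^ k
  0≤2^ zero      = 0≤1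
  0≤2^ (ℕ.suc k) = *-nonneg (+-nonneg 0≤1 0≤1) (0≤2^ k)

  1≤2^ : ∀ k → 1# ≤ 2# ^ k
  1≤2^ zero      = ≤-refl
  1≤2^ (ℕ.suc k) = begin
    1#                           ≤⟨ 1≤2^ k ⟩
    2# ^ k                       ≈⟨ +-identityʳ _ ⟨
    2# ^ k + 0#                  ≤⟨ +-monoʳ-≤ _ (0≤2^ k) ⟩
    2# ^ k + 2# ^ k              ≈⟨ +-cong (*-identityˡ _) (*-identityˡ _) ⟨
    1# * 2# ^ k + 1# * 2# ^ k    ≈⟨ distribʳ (2# ^ k) 1# 1# ⟨
    2# * 2# ^ k                  ∎

  2^≉0 : ∀ k → ¬ 2# ^ k ≈ 0#
  2^≉0 k eq = 0≉1 (≤-antisym 0≤1 (≤-respʳ-≈ eq (1≤2^ k)))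

  ∑-const : ∀ {k} c → ∑ {k} (λ _ → c) ≈ 2# ^ k * c
  ∑-const {zero}    c = sym (*-identityˡ c)
  ∑-const {ℕ.suc k} c = begin-equality
    ∑ {k} (λ _ → c) + ∑ {k} (λ _ → c)            ≈⟨ +-cong (∑-const {k} c) (∑-const {k} c) ⟩
    2# ^ k * c + 2# ^ k * c                      ≈⟨ +-cong (*-identityˡ _) (*-identityˡ _) ⟨
    1# * (2# ^ k * c) + 1# * (2# ^ k * c)        ≈⟨ distribʳ _ 1# 1# ⟨
    2# * (2# ^ k * c)                            ≈⟨ *-assoc 2# (2# ^ k) c ⟨
    2# * 2# ^ k * c                              ∎

  Unif : ∀ k → Distribution k
  Unif k = record
    { mass        = λ _ → (2# ^ k) ⁻¹
    ; mass-nonneg = λ _ → ⁻¹-nonneg (2^≉0 k) (0≤2^ k)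
    ; mass-total  = trans (∑-const {k} _) (*-inverseʳ (2^≉0 k))
    }

  indicator : Bool → Carrier
  indicator b = if b then 1# else 0#

  0≤indicator : ∀ b → 0# ≤ indicator b
  0≤indicator true  = 0≤1
  0≤indicator false = ≤-refl

  indicator≤1 : ∀ b → indicator b ≤ 1#
  indicator≤1 true  = ≤-refl
  indicator≤1 false = 0≤1

  ρ : ∀ {k} → Subset k → Carrier
  ρ {k} S = 𝔼 (Unif k) λ b → indicator (f S b)

  λ[_] : ∀ {k} → Subset k → Δ k → UnitInterval → Carrier
  λ[_] {k} S (D , _) p = 𝔼 D λ a → 𝔼 (Bern p k) λ b → indicator (f S (a ⊙ b))

  sign : Sign → Carrier
  sign Sign.+ = 1#
  sign Sign.- = - 1#

  μ : ∀ {n} → Δ (ℕ.suc n) → Carrier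
  μ (D , _) = 𝔼 D λ b → sign (head b)

  𝟙 : UnitInterval
  𝟙 = 1# , 0≤1 , ≤-refl

  γ[_] : ∀ {k} → Subset k → Δ k → Carrier
  γ[ S ] D = λ[ S ] D 𝟙

  0≤λ : ∀ {k} (S : Subset k) D p → 0# ≤ λ[ S ] D p
  0≤λ {k} S (D , _) p = 𝔼-nonneg D λ a → 𝔼-nonneg (Bern p k) λ b → 0≤indicator (f S (a ⊙ b))

  λ≤1 : ∀ {k} (S : Subset k) D p → λ[ S ] D p ≤ 1#
  λ≤1 {k} S (D , _) p = 𝔼≤1 D λ a → 𝔼≤1 (Bern p k) λ b → indicator≤1 (f S (a ⊙ b))

  β-sup : ∀ {k} (S : Subset k) (D : Δ k) → ∃ (IsSupremum _≤_ (λ[ S ] D))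
  β-sup S D = complete (λ[ S ] D) 𝟙 (1# , λ≤1 S D)

  β[_] : ∀ {k} → Subset k → Δ k → Carrier
  β[ S ] D = proj₁ (β-sup S D)

  0≤β : ∀ {k} (S : Subset k) D → 0# ≤ β[ S ] D
  0≤β S D = ≤-trans (0≤λ S D 𝟙) (proj₁ (proj₂ (β-sup S D)) 𝟙)

  MatchedPair : ℕ → Set ℓ
  MatchedPair n = Σ (Δ (ℕ.suc n) × Δ (ℕ.suc n)) λ (Dₙ , Dᵧ) → μ Dₙ ≈ μ Dᵧ

  -- Carrier ⁺ adjoins ⊤⁺ = +∞ to the reals.
  ratio : ∀ {n} → Subset (ℕ.suc n) → MatchedPair n → Carrier ⁺
  ratio S ((Dₙ , Dᵧ) , _) =
    if does (γ[ S ] Dᵧ ≟ 0#) then ⊤⁺ else [ β[ S ] Dₙ / γ[ S ] Dᵧ ]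

  0≤ratio : ∀ {n} (S : Subset (ℕ.suc n)) P → [ 0# ] ≤⁺ ratio S P
  0≤ratio S ((Dₙ , Dᵧ) , _) with γ[ S ] Dᵧ ≟ 0#
  ... | yes _  = [ 0# ] ≤⊤⁺
  ... | no γ≉0 = [ *-nonneg (0≤β S Dₙ) (⁻¹-nonneg γ≉0 (0≤λ S Dᵧ 𝟙)) ]

  UnifΔ : ∀ k → Δ k
  UnifΔ k = Unif k , λ _ _ _ → refl

  ofWeight : ∀ {k} (w : ℕ) → w ℕ.≤ k → ∃ λ (x : Vec Sign k) → wt x ≡ w
  ofWeight {zero}    zero      z≤n       = [] , ≡.refl
  ofWeight {ℕ.suc k} zero      z≤n       with ofWeight {k} zero z≤n
  ... | x , eq = Sign.- ∷ x , eq
  ofWeight {ℕ.suc k} (ℕ.suc w) (s≤s w≤k) with ofWeight {k} w w≤k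
  ... | x , eq = Sign.+ ∷ x , ≡.cong ℕ.suc eq

  ⊙-identityʳ : ∀ {k} (x : Vec Sign k) → x ⊙ replicate k Sign.+ ≡ x
  ⊙-identityʳ []      = ≡.refl
  ⊙-identityʳ (s ∷ x) = ≡.cong₂ _∷_ (Sign.*-identityʳ s) (⊙-identityʳ x)

  bernMass-𝟙 : ∀ k → bernMass 1# (replicate k Sign.+) ≈ 1#
  bernMass-𝟙 zero      = refl
  bernMass-𝟙 (ℕ.suc k) = trans (*-identityˡ _) (bernMass-𝟙 k)

  γ-Unif≉0 : ∀ {k} (S : Subset k) → Nonempty S → ¬ γ[ S ] (UnifΔ k) ≈ 0#
  γ-Unif≉0 {k} S (i , i∈S) γ≈0 = 0≉1 (begin-equality
    0#            ≈⟨ zeroʳ _ ⟨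
    2# ^ k * 0#   ≈⟨ *-congˡ c≈0 ⟨
    2# ^ k * c    ≈⟨ *-inverseʳ (2^≉0 k) ⟩
    1#            ∎)
    where
    c : Carrier
    c = (2# ^ k) ⁻¹

    0≤c : 0# ≤ c
    0≤c = ⁻¹-nonneg (2^≉0 k) (0≤2^ k)

    x : Vec Sign k
    x = proj₁ (ofWeight (ℕ.suc (toℕ i)) (toℕ<n i))

    fx≡true : f S (x ⊙ replicate k Sign.+) ≡ true
    fx≡true rewrite ⊙-identityʳ x =
      dec-true (wt x ∈[ S ]?)
        (i , i∈S , ≡.sym (proj₂ (ofWeight (ℕ.suc (toℕ i)) (toℕ<n i))))

    inner : Vec Sign k → Carrier
    inner a = 𝔼 (Bern 𝟙 k) λ b → indicator (f S (a ⊙ b))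

    0≤inner : ∀ a → 0# ≤ inner a
    0≤inner a = 𝔼-nonneg (Bern 𝟙 k) λ b → 0≤indicator (f S (a ⊙ b))

    1≤inner : 1# ≤ inner x
    1≤inner = begin
      1#                                      ≈⟨ bernMass-𝟙 k ⟨
      bernMass 1# (replicate k Sign.+)        ≈⟨ *-identityʳ _ ⟨
      bernMass 1# (replicate k Sign.+) * 1#
        ≡⟨ ≡.cong (λ b → bernMass 1# (replicate k Sign.+) * indicator b) fx≡true ⟨
      bernMass 1# (replicate k Sign.+) * indicator (f S (x ⊙ replicate k Sign.+))
        ≤⟨ term≤∑ (λ b → *-nonneg (mass-nonneg (Bern 𝟙 k) b) (0≤indicator (f S (x ⊙ b))))
             (replicate k Sign.+) ⟩
      inner x                                 ∎

    c≈0 : c ≈ 0#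
    c≈0 = ≤-antisym (begin
      c                     ≈⟨ *-identityʳ c ⟨
      c * 1#                ≤⟨ *-monoˡ-≤ 0≤c 1≤inner ⟩
      c * inner x           ≤⟨ term≤∑ (λ a → *-nonneg 0≤c (0≤inner a)) x ⟩
      γ[ S ] (UnifΔ k)      ≈⟨ γ≈0 ⟩
      0#                    ∎) 0≤c

  -- The infimum in Carrier ⁺ is finite since S is nonempty.
  α-inf : ∀ {n} (S : Subset (ℕ.suc n)) → Nonempty S →
          ∃ λ m → IsInfimum _≤⁺_ (ratio S) [ m ]
  α-inf {n} S S≢∅ = complete-inf⁺ (ratio S) (U , _ , ratioU) (0# , 0≤ratio S)
    where
    U : MatchedPair n
    U = (UnifΔ _ , UnifΔ _) , refl

    ratioU : ratio S U ≡ [ β[ S ] (UnifΔ _) / γ[ S ] (UnifΔ _) ]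
    ratioU = ≡.cong (if_then ⊤⁺ else [ β[ S ] (UnifΔ _) / γ[ S ] (UnifΔ _) ])
      (dec-false (γ[ S ] (UnifΔ _) ≟ 0#) (γ-Unif≉0 S S≢∅))

  α : ∀ {n} (S : Subset (ℕ.suc n)) → Nonempty S → Carrier
  α S S≢∅ = proj₁ (α-inf S S≢∅)

  -- The limit along odd k of a sequence indexed by m, where k = 2m + 1.
  _⟶_along-odd : (ℕ → Carrier) → Carrier → Set ℓ
  u ⟶ l along-odd = ∀ ε → 0# < ε →
    ∃ λ K → ∀ m → K ℕ.≤ ℕ.suc (2 ℕ.* m) → ∣ u m - l ∣ < ε

{-# OPTIONS --safe #-}

-- A Bernoulli(1/2) mask makes every vector uniform, so β(D) ≥ λ(D, 1/2) = ρ for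
-- every D, while γ ≤ 1; hence α ≥ ρ.  Conversely, with k = 2m + 1, let D_Y be
-- uniform on the vectors of weight m + 1, so that γ(D_Y) = 1 and μ(D_Y) = 1/k,
-- and let D_N be 1ᵏ with probability q = (m + 1)/k and (-1)ᵏ otherwise, which
-- has the same μ.  Since q ≥ 1/2,
--   λ(D_N, p) = C(k, m+1) (p (1 - p))ᵐ (q p + (1 - q) (1 - p)) ≤ C(k, m+1) 4⁻ᵐ q = 2 q ρ,
-- and therefore 1 ≤ α/ρ ≤ 2 q = 1 + 1/k.

module Submission where

open import Defs

import Algebra.Construct.NaturalChoice.Max as Max
import Algebra.Construct.NaturalChoice.MaxOp as MaxOp
import Algebra.Properties.CommutativeSemiring.Exp as Exp
import Algebra.Properties.Monoid.Mult as Mult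
import Algebra.Properties.Ring as RingProperties
import Algebra.Solver.Ring.NaturalCoefficients.Default as SemiringSolver
open import Data.Bool.Base using (Bool; true; false; if_then_else_)
open import Data.Fin.Base using (toℕ)
open import Data.Fin.Properties using (toℕ-fromℕ<)
open import Data.Fin.Subset using (Subset; Nonempty)
open import Data.Fin.Subset.Properties using (x∈⁅x⁆; x∈⁅y⁆⇒x≡y)
import Data.Nat.Base as ℕ
open ℕ using (ℕ; zero; suc; _≡ᵇ_; z≤n; s≤s)
import Data.Nat.Properties as ℕ
open import Data.Product.Base using (_,_; proj₁; proj₂)
import Data.Sign.Base as Sign
open Sign using (Sign)
import Data.Sign.Properties as Sign
open import Data.Sum.Base using (inj₁; inj₂)
open import Data.Vec.Base using (Vec; []; _∷_; head; replicate)
open import Data.Vec.Properties using (count≤n)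
open import Function.Base using (_∘_)
open import Function.Bundles using (mk⇔)
open import Relation.Binary.PropositionalEquality as ≡ using (_≡_)
open import Relation.Binary.Construct.Add.Supremum.NonStrict using (≤⁺-trans)
import Relation.Binary.Reasoning.PartialOrder as ≤-Reasoning
open import Relation.Nullary.Construct.Add.Supremum using (⊤⁺; [_])
open import Relation.Nullary.Decidable using (Dec; does; yes; no; does-⇔; dec-true; dec-false)
open import Relation.Nullary.Negation.Core using (¬_; contradiction)

-- Sign vectors and the middle weight.

-- Index `i` stands for the weight `toℕ i + 1`, so membership in the singleton means weight `m + 1`,
-- and equivalent decidable propositions have equal Booleans. The test `_≡ᵇ_` reduces under `suc`,
-- which the layer counts rely on.
f-middle : ∀ m (x : Vec Sign (suc (2 ℕ.* m))) → f (middle m) x ≡ (wt x ≡ᵇ suc m)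
f-middle m x = does-⇔ (mk⇔ to from) (wt x ∈[ middle m ]?) (wt x ℕ.≟ suc m)
  where
  i<k : m ℕ.< suc (2 ℕ.* m)
  i<k = s≤s (ℕ.m≤m+n m (m ℕ.+ 0))

  to : wt x ∈[ middle m ] → wt x ≡ suc m
  to (i , i∈S , eq) = ≡.trans (≡.sym eq) (≡.cong suc
    (≡.trans (≡.cong toℕ (x∈⁅y⁆⇒x≡y _ i∈S)) (toℕ-fromℕ< i<k)))

  from : wt x ≡ suc m → wt x ∈[ middle m ]
  from eq = _ , x∈⁅x⁆ _ , ≡.trans (≡.cong suc (toℕ-fromℕ< i<k)) (≡.sym eq)

⊙-identityˡ : ∀ {k} (x : Vec Sign k) → replicate k Sign.+ ⊙ x ≡ x
⊙-identityˡ []      = ≡.refl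
⊙-identityˡ (s ∷ x) = ≡.cong (s ∷_) (⊙-identityˡ x)

⊙-involutive : ∀ {k} (a x : Vec Sign k) → a ⊙ (a ⊙ x) ≡ x
⊙-involutive []      []      = ≡.refl
⊙-involutive (s ∷ a) (t ∷ x) = ≡.cong₂ _∷_
  (≡.trans (≡.sym (Sign.*-assoc s s t)) (≡.cong (Sign._* t) (Sign.s*s≡+ s)))
  (⊙-involutive a x)

-- Arithmetic in an ordered field.

module OrderedFieldLemmas {ℓ} (R : CompleteOrderedField ℓ) where
  open CompleteOrderedField R
  open OrderedFieldProperties R
  open RingProperties ring
  open ≤-Reasoning poset
  open SemiringSolver commutativeSemiring


  *-monoʳ-≤ : ∀ {x y z} → 0# ≤ z → x ≤ y → x * z ≤ y * z
  *-monoʳ-≤ {x} {y} {z} 0≤z x≤y = begin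
    x * z  ≈⟨ *-comm x z ⟩
    z * x  ≤⟨ *-monoˡ-≤ 0≤z x≤y ⟩
    z * y  ≈⟨ *-comm z y ⟩
    y * z  ∎

  *-mono-≤ : ∀ {x y u v} → 0# ≤ u → 0# ≤ y → x ≤ y → u ≤ v → x * u ≤ y * v
  *-mono-≤ 0≤u 0≤y x≤y u≤v = ≤-trans (*-monoʳ-≤ 0≤u x≤y) (*-monoˡ-≤ 0≤y u≤v)

  ^-nonneg : ∀ {x} n → 0# ≤ x → 0# ≤ x ^ n
  ^-nonneg zero    0≤x = 0≤1
  ^-nonneg (suc n) 0≤x = *-nonneg 0≤x (^-nonneg n 0≤x)

  ^-monoˡ-≤ : ∀ {x y} n → 0# ≤ x → x ≤ y → x ^ n ≤ y ^ n
  ^-monoˡ-≤ zero    0≤x x≤y = ≤-refl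
  ^-monoˡ-≤ (suc n) 0≤x x≤y =
    *-mono-≤ (^-nonneg n 0≤x) (≤-trans 0≤x x≤y) x≤y (^-monoˡ-≤ n 0≤x x≤y)

  0≤x² : ∀ x → 0# ≤ x * x
  0≤x² x with ≤-total 0# x
  ... | inj₁ 0≤x = *-nonneg 0≤x 0≤x
  ... | inj₂ x≤0 = ≤-respʳ-≈ eq (*-nonneg 0≤-x 0≤-x)
    where
    0≤-x : 0# ≤ - x
    0≤-x = ≤-respˡ-≈ -0#≈0# (neg-anti-≤ x≤0)
    eq : - x * - x ≈ x * x
    eq = begin-equality
      - x * - x      ≈⟨ -‿distribˡ-* x (- x) ⟨
      - (x * - x)    ≈⟨ -‿cong (-‿distribʳ-* x x) ⟨
      - - (x * x)    ≈⟨ -‿involutive (x * x) ⟩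
      x * x          ∎

  y+[x-y]≈x : ∀ x y → y + (x - y) ≈ x
  y+[x-y]≈x x y = begin-equality
    y + (x - y)    ≈⟨ +-comm y (x - y) ⟩
    x - y + y      ≈⟨ +-assoc x (- y) y ⟩
    x + (- y + y)  ≈⟨ +-congˡ (-‿inverseˡ y) ⟩
    x + 0#         ≈⟨ +-identityʳ x ⟩
    x              ∎

  x+y≈z⇒y≈z-x : ∀ {x y z} → x + y ≈ z → y ≈ z - x
  x+y≈z⇒y≈z-x {x} {y} {z} eq = +-cancelˡ x y (z - x) (trans eq (sym (y+[x-y]≈x z x)))

  1-[1-x]≈x : ∀ x → 1# - (1# - x) ≈ x
  1-[1-x]≈x x = sym (x+y≈z⇒y≈z-x (trans (+-comm _ x) (y+[x-y]≈x 1# x)))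

  x*x⁻¹*y≈y : ∀ {x} y → ¬ x ≈ 0# → x * (x ⁻¹ * y) ≈ y
  x*x⁻¹*y≈y {x} y x≉0 = begin-equality
    x * (x ⁻¹ * y)  ≈⟨ *-assoc x (x ⁻¹) y ⟨
    x * x ⁻¹ * y    ≈⟨ *-congʳ (*-inverseʳ x≉0) ⟩
    1# * y          ≈⟨ *-identityˡ y ⟩
    y               ∎

  *-inverseˡ : ∀ {x} → ¬ x ≈ 0# → x ⁻¹ * x ≈ 1#
  *-inverseˡ x≉0 = trans (*-comm _ _) (*-inverseʳ x≉0)

  ⁻¹-unique : ∀ {x y} → ¬ x ≈ 0# → x * y ≈ 1# → y ≈ x ⁻¹
  ⁻¹-unique {x} {y} x≉0 xy≈1 = begin-equality
    y               ≈⟨ *-identityˡ y ⟨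
    1# * y          ≈⟨ *-congʳ (*-inverseˡ x≉0) ⟨
    x ⁻¹ * x * y    ≈⟨ *-assoc _ x y ⟩
    x ⁻¹ * (x * y)  ≈⟨ *-congˡ xy≈1 ⟩
    x ⁻¹ * 1#       ≈⟨ *-identityʳ _ ⟩
    x ⁻¹            ∎

  -- Dividing a nonnegative number by `z ≤ 1` can only enlarge it. With a value of `γ` as `z`, this
  -- disposes of the denominator of a ratio.
  x≤y⇒x≤y/z : ∀ {x y z} → 0# ≤ x → x ≤ y → ¬ z ≈ 0# → 0# ≤ z → z ≤ 1# → x ≤ y / z
  x≤y⇒x≤y/z {x} {y} {z} 0≤x x≤y z≉0 0≤z z≤1 = begin
    x               ≈⟨ x*x⁻¹*y≈y x z≉0 ⟨
    z * (z ⁻¹ * x)  ≤⟨ *-monoʳ-≤ (*-nonneg 0≤z⁻¹ 0≤x) z≤1 ⟩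
    1# * (z ⁻¹ * x) ≈⟨ *-identityˡ _ ⟩
    z ⁻¹ * x        ≈⟨ *-comm _ x ⟩
    x * z ⁻¹        ≤⟨ *-monoʳ-≤ 0≤z⁻¹ x≤y ⟩
    y / z           ∎
    where
    0≤z⁻¹ : 0# ≤ z ⁻¹
    0≤z⁻¹ = ⁻¹-nonneg z≉0 0≤z

  x/1≈x : ∀ x {z} → z ≈ 1# → x / z ≈ x
  x/1≈x x {z} z≈1 = trans (*-congˡ (sym (⁻¹-unique z≉0 (trans (*-identityʳ z) z≈1)))) (*-identityʳ x)
    where
    z≉0 : ¬ z ≈ 0#
    z≉0 z≈0 = 0≉1 (trans (sym z≈0) z≈1)

  1≤x⇒x≉0 : ∀ {x} → 1# ≤ x → ¬ x ≈ 0#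
  1≤x⇒x≉0 1≤x x≈0 = 0≉1 (≤-antisym 0≤1 (≤-respʳ-≈ x≈0 1≤x))

  -- `_<_` is `_≤_` together with `≉`, so strictness amounts to refuting `x ≈ z`, which would turn
  -- `x ≤ y` into `z ≤ y`.
  ≤∧≱⇒< : ∀ {x y z} → x ≤ y → ¬ z ≤ y → x < z
  ≤∧≱⇒< {x} {y} {z} x≤y z≰y with ≤-total x z
  ... | inj₁ x≤z = x≤z , λ x≈z → z≰y (≤-respˡ-≈ x≈z x≤y)
  ... | inj₂ z≤x = contradiction (≤-trans z≤x x≤y) z≰y

  ∣x∣≤y : ∀ {x y} → 0# ≤ x → x ≤ y → ∣ x ∣ ≤ y
  ∣x∣≤y {x} {y} 0≤x x≤y = ⊔-lub x≤y (begin
    - x  ≤⟨ neg-anti-≤ 0≤x ⟩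
    - 0# ≈⟨ -0#≈0# ⟩
    0#   ≤⟨ 0≤x ⟩
    x    ≤⟨ x≤y ⟩
    y    ∎)
    where open MaxOp (Max.maxOperator totalOrder) using (⊔-lub)

  -- Division by `y` puts `x / y` between `1#` and `c`. It is applied to `α`, `ρ` and `c = 2q`.
  ∣x/y-1∣≤c-1 : ∀ {x y c} → ¬ y ≈ 0# → 0# ≤ y → y ≤ x → x ≤ c * y → ∣ x / y - 1# ∣ ≤ c - 1#
  ∣x/y-1∣≤c-1 {x} {y} {c} y≉0 0≤y y≤x x≤cy =
    ∣x∣≤y (x≤y⇒0≤y-x 1≤x/y) (+-monoˡ-≤ (- 1#) x/y≤c)
    where
    0≤y⁻¹ : 0# ≤ y ⁻¹
    0≤y⁻¹ = ⁻¹-nonneg y≉0 0≤y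

    1≤x/y : 1# ≤ x / y
    1≤x/y = ≤-respˡ-≈ (*-inverseʳ y≉0) (*-monoʳ-≤ 0≤y⁻¹ y≤x)

    x/y≤c : x / y ≤ c
    x/y≤c = begin
      x * y ⁻¹        ≤⟨ *-monoʳ-≤ 0≤y⁻¹ x≤cy ⟩
      c * y * y ⁻¹    ≈⟨ *-assoc c y (y ⁻¹) ⟩
      c * (y * y ⁻¹)  ≈⟨ *-congˡ (*-inverseʳ y≉0) ⟩
      c * 1#          ≈⟨ *-identityʳ c ⟩
      c               ∎

  ·-nonneg : ∀ n → 0# ≤ n · 1#
  ·-nonneg zero    = ≤-refl
  ·-nonneg (suc n) = +-nonneg 0≤1 (·-nonneg n)

  ·-monoˡ-≤ : ∀ {m n} → m ℕ.≤ n → m · 1# ≤ n · 1#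
  ·-monoˡ-≤ {n = n} z≤n = ·-nonneg n
  ·-monoˡ-≤ (s≤s m≤n)   = +-monoʳ-≤ 1# (·-monoˡ-≤ m≤n)

  1≤1+n : ∀ n → 1# ≤ suc n · 1#
  1≤1+n n = ≤-respˡ-≈ (+-identityʳ 1#) (+-monoʳ-≤ 1# (·-nonneg n))

  -- Both factors are written as h ± (p − h).
  p[1-p]≤h² : ∀ {h} p → h + h ≈ 1# → p * (1# - p) ≤ h * h
  p[1-p]≤h² {h} p h+h≈1 = begin
    p * (1# - p)                      ≈⟨ *-cong p≈ 1-p≈ ⟩
    (h + d) * (h - d)                 ≈⟨ +-identityʳ _ ⟨
    (h + d) * (h - d) + 0#            ≤⟨ +-monoʳ-≤ _ (0≤x² d) ⟩
    (h + d) * (h - d) + d * d         ≈⟨ expand h d (- d) ⟩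
    h * h + (h + d) * (d - d)         ≈⟨ +-congˡ (*-congˡ (-‿inverseʳ d)) ⟩
    h * h + (h + d) * 0#              ≈⟨ +-congˡ (zeroʳ _) ⟩
    h * h + 0#                        ≈⟨ +-identityʳ _ ⟩
    h * h                             ∎
    where
    d : Carrier
    d = p - h

    expand : ∀ h d e → (h + d) * (h + e) + d * d ≈ h * h + (h + d) * (d + e)
    expand = solve 3 (λ h d e → (h :+ d) :* (h :+ e) :+ d :* d
                             := h :* h :+ (h :+ d) :* (d :+ e)) refl

    p≈ : p ≈ h + d
    p≈ = sym (y+[x-y]≈x p h)

    1-p≈ : 1# - p ≈ h - d
    1-p≈ = sym (x+y≈z⇒y≈z-x (begin-equality
      p + (h - d)        ≈⟨ +-congʳ p≈ ⟩
      h + d + (h - d)    ≈⟨ +-assoc h d _ ⟩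
      h + (d + (h - d))  ≈⟨ +-congˡ (y+[x-y]≈x h d) ⟩
      h + h              ≈⟨ h+h≈1 ⟩
      1#                 ∎))

module SketchingLemmas {ℓ} (R : CompleteOrderedField ℓ) where
  open CompleteOrderedField R
  open OrderedFieldProperties R
  open OrderedFieldLemmas R
  open Sketching R
  open RingProperties ring
  open Mult +-monoid using (×-congˡ; ×-homo-+)
  open Exp commutativeSemiring using (^-congˡ; ^-congʳ; ^-distrib-*)
  open SemiringSolver commutativeSemiring
  open ≤-Reasoning poset

  -- Sums over the cube, expectations and mixtures.

  ∑-distrib-+ : ∀ {k} (g h : Vec Sign k → Carrier) → ∑ (λ x → g x + h x) ≈ ∑ g + ∑ h
  ∑-distrib-+ {zero}  g h = refl
  ∑-distrib-+ {suc k} g h = trans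
    (+-cong (∑-distrib-+ (g ∘ (_ ∷_)) (h ∘ (_ ∷_))) (∑-distrib-+ (g ∘ (_ ∷_)) (h ∘ (_ ∷_))))
    (solve 4 (λ a b c d → (a :+ b) :+ (c :+ d) := (a :+ c) :+ (b :+ d)) refl _ _ _ _)

  ∑-zero : ∀ {k} {g : Vec Sign k → Carrier} → (∀ x → g x ≈ 0#) → ∑ g ≈ 0#
  ∑-zero {zero}  g≈0 = g≈0 []
  ∑-zero {suc k} g≈0 =
    trans (+-cong (∑-zero (g≈0 ∘ (_ ∷_))) (∑-zero (g≈0 ∘ (_ ∷_)))) (+-identityˡ 0#)

  -- Multiplication by `a` permutes the cube: at each coordinate where `a` is negative the two
  -- halves of the sum change places.
  ∑-⊙ : ∀ {k} (a : Vec Sign k) (g : Vec Sign k → Carrier) → ∑ (g ∘ (a ⊙_)) ≈ ∑ g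
  ∑-⊙ []           g = refl
  ∑-⊙ (Sign.+ ∷ a) g = +-cong (∑-⊙ a (g ∘ (_ ∷_))) (∑-⊙ a (g ∘ (_ ∷_)))
  ∑-⊙ (Sign.- ∷ a) g =
    trans (+-cong (∑-⊙ a (g ∘ (_ ∷_))) (∑-⊙ a (g ∘ (_ ∷_)))) (+-comm _ _)

  𝔼-cong : ∀ {k} (D : Distribution k) {g h} → (∀ x → g x ≈ h x) → 𝔼 D g ≈ 𝔼 D h
  𝔼-cong D g≈h = ∑-cong λ x → *-congˡ (g≈h x)

  𝔼-const : ∀ {k} (D : Distribution k) c → 𝔼 D (λ _ → c) ≈ c
  𝔼-const D c = begin-equality
    ∑ (λ x → mass D x * c)  ≈⟨ ∑-cong (λ x → *-comm (mass D x) c) ⟩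
    ∑ (λ x → c * mass D x)  ≈⟨ ∑-*ˡ c (mass D) ⟩
    c * ∑ (mass D)          ≈⟨ *-congˡ (mass-total D) ⟩
    c * 1#                  ≈⟨ *-identityʳ c ⟩
    c                       ∎

  mix : ∀ {k} → UnitInterval → Distribution k → Distribution k → Distribution k
  mix (q , 0≤q , q≤1) P Q = record
    { mass        = λ x → q * mass P x + (1# - q) * mass Q x
    ; mass-nonneg = λ x → +-nonneg (*-nonneg 0≤q (mass-nonneg P x))
                                   (*-nonneg (x≤y⇒0≤y-x q≤1) (mass-nonneg Q x))
    ; mass-total  = begin-equality
        ∑ (λ x → q * mass P x + (1# - q) * mass Q x)
          ≈⟨ ∑-distrib-+ (λ x → q * mass P x) _ ⟩
        ∑ (λ x → q * mass P x) + ∑ (λ x → (1# - q) * mass Q x)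
          ≈⟨ +-cong (∑-*ˡ q (mass P)) (∑-*ˡ (1# - q) (mass Q)) ⟩
        q * ∑ (mass P) + (1# - q) * ∑ (mass Q)
          ≈⟨ +-cong (*-congˡ (mass-total P)) (*-congˡ (mass-total Q)) ⟩
        q * 1# + (1# - q) * 1#
          ≈⟨ +-cong (*-identityʳ q) (*-identityʳ _) ⟩
        q + (1# - q)
          ≈⟨ y+[x-y]≈x 1# q ⟩
        1# ∎
    }

  𝔼-mix : ∀ {k} (q : UnitInterval) (P Q : Distribution k) g →
          𝔼 (mix q P Q) g ≈ proj₁ q * 𝔼 P g + (1# - proj₁ q) * 𝔼 Q g
  𝔼-mix (q , _) P Q g = begin-equality
    ∑ (λ x → (q * mass P x + (1# - q) * mass Q x) * g x)
      ≈⟨ ∑-cong (λ x → solve 5 (λ q p q′ p′ g → (q :* p :+ q′ :* p′) :* g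
                                             := q :* (p :* g) :+ q′ :* (p′ :* g))
                         refl q (mass P x) (1# - q) (mass Q x) (g x)) ⟩
    ∑ (λ x → q * (mass P x * g x) + (1# - q) * (mass Q x * g x))
      ≈⟨ ∑-distrib-+ (λ x → q * (mass P x * g x)) _ ⟩
    ∑ (λ x → q * (mass P x * g x)) + ∑ (λ x → (1# - q) * (mass Q x * g x))
      ≈⟨ +-cong (∑-*ˡ q (λ x → mass P x * g x)) (∑-*ˡ (1# - q) (λ x → mass Q x * g x)) ⟩
    q * 𝔼 P g + (1# - q) * 𝔼 Q g ∎

  -- Bernoulli masses: symmetry, endpoints and complement.

  bernMass-wt : ∀ {k} p (x : Vec Sign k) →
                bernMass p x ≈ p ^ wt x * (1# - p) ^ (k ℕ.∸ wt x)
  bernMass-wt         p []           = sym (*-identityˡ 1#)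
  bernMass-wt         p (Sign.+ ∷ x) = trans (*-congˡ (bernMass-wt p x)) (sym (*-assoc _ _ _))
  bernMass-wt {suc k} p (Sign.- ∷ x) = begin-equality
    (1# - p) * bernMass p x
      ≈⟨ *-congˡ (bernMass-wt p x) ⟩
    (1# - p) * (p ^ wt x * (1# - p) ^ (k ℕ.∸ wt x))
      ≈⟨ solve 3 (λ a b c → a :* (b :* c) := b :* (a :* c)) refl _ _ _ ⟩
    p ^ wt x * (1# - p) ^ suc (k ℕ.∸ wt x)
      -- Subtraction is truncated, so moving `suc` across it needs `wt x ≤ k`.
      ≈⟨ *-congˡ (^-congʳ (1# - p) (ℕ.+-∸-assoc 1 (count≤n (Sign._≟ Sign.+) x))) ⟨
    p ^ wt x * (1# - p) ^ (suc k ℕ.∸ wt x) ∎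

  Bern-symmetric : ∀ {k} p → Symmetric (Bern p k)
  Bern-symmetric {k} (p , _) x y eq = begin-equality
    bernMass p x                             ≈⟨ bernMass-wt p x ⟩
    p ^ wt x * (1# - p) ^ (k ℕ.∸ wt x)       ≡⟨ ≡.cong (λ w → p ^ w * (1# - p) ^ (k ℕ.∸ w)) eq ⟩
    p ^ wt y * (1# - p) ^ (k ℕ.∸ wt y)       ≈⟨ bernMass-wt p y ⟨
    bernMass p y                             ∎

  mix-symmetric : ∀ {k} q (P Q : Distribution k) →
                  Symmetric P → Symmetric Q → Symmetric (mix q P Q)
  mix-symmetric q P Q P-sym Q-sym x y eq =
    +-cong (*-congˡ (P-sym x y eq)) (*-congˡ (Q-sym x y eq))

  𝟘 : UnitInterval
  𝟘 = 0# , ≤-refl , 0≤1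

  _ᶜ : UnitInterval → UnitInterval
  (p , 0≤p , p≤1) ᶜ = 1# - p , x≤y⇒0≤y-x p≤1 , (begin
    1# - p        ≈⟨ +-identityˡ _ ⟨
    0# + (1# - p) ≤⟨ +-monoˡ-≤ _ 0≤p ⟩
    p + (1# - p)  ≈⟨ y+[x-y]≈x 1# p ⟩
    1#            ∎)

  -- At `p = 1` every vector with a negative coordinate has mass zero. This point mass serves both
  -- as the mask in `γ` and as one of the two constant vectors in `extremes`.
  𝔼-Bern-1 : ∀ k (g : Vec Sign k → Carrier) → 𝔼 (Bern 𝟙 k) g ≈ g (replicate k Sign.+)
  𝔼-Bern-1 zero    g = *-identityˡ _
  𝔼-Bern-1 (suc k) g = begin-equality
    ∑ (λ x → 1# * bernMass 1# x * g (Sign.+ ∷ x))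
      + ∑ (λ x → (1# - 1#) * bernMass 1# x * g (Sign.- ∷ x))
      ≈⟨ +-cong
           (∑-cong {k} λ x → *-congʳ (*-identityˡ _))
           (∑-zero {k} λ x → trans (*-congʳ (trans (*-congʳ (-‿inverseʳ 1#)) (zeroˡ _))) (zeroˡ _)) ⟩
    𝔼 (Bern 𝟙 k) (g ∘ (Sign.+ ∷_)) + 0#
      ≈⟨ +-identityʳ _ ⟩
    𝔼 (Bern 𝟙 k) (g ∘ (Sign.+ ∷_))
      ≈⟨ 𝔼-Bern-1 k (g ∘ (Sign.+ ∷_)) ⟩
    g (replicate (suc k) Sign.+) ∎

  1-0≈1 : 1# - 0# ≈ 1#
  1-0≈1 = trans (+-congˡ -0#≈0#) (+-identityʳ 1#)

  𝔼-Bern-0 : ∀ k (g : Vec Sign k → Carrier) → 𝔼 (Bern 𝟘 k) g ≈ g (replicate k Sign.-)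
  𝔼-Bern-0 zero    g = *-identityˡ _
  𝔼-Bern-0 (suc k) g = begin-equality
    ∑ (λ x → 0# * bernMass 0# x * g (Sign.+ ∷ x))
      + ∑ (λ x → (1# - 0#) * bernMass 0# x * g (Sign.- ∷ x))
      ≈⟨ +-cong
           (∑-zero {k} λ x → trans (*-congʳ (zeroˡ _)) (zeroˡ _))
           (∑-cong {k} λ x → *-congʳ (trans (*-congʳ 1-0≈1) (*-identityˡ _))) ⟩
    0# + 𝔼 (Bern 𝟘 k) (g ∘ (Sign.- ∷_))
      ≈⟨ +-identityˡ _ ⟩
    𝔼 (Bern 𝟘 k) (g ∘ (Sign.- ∷_))
      ≈⟨ 𝔼-Bern-0 k (g ∘ (Sign.- ∷_)) ⟩
    g (replicate (suc k) Sign.-) ∎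

  bernMass-flip : ∀ {k} p (x : Vec Sign k) →
                  bernMass p (replicate k Sign.- ⊙ x) ≈ bernMass (1# - p) x
  bernMass-flip p []           = refl
  bernMass-flip p (Sign.+ ∷ x) = *-congˡ (bernMass-flip p x)
  bernMass-flip p (Sign.- ∷ x) = *-cong (sym (1-[1-x]≈x p)) (bernMass-flip p x)

  𝔼-Bern-flip : ∀ {k} p (g : Vec Sign k → Carrier) →
                𝔼 (Bern p k) (g ∘ (replicate k Sign.- ⊙_)) ≈ 𝔼 (Bern (p ᶜ) k) g
  𝔼-Bern-flip {k} (p , _) g = begin-equality
    ∑ (λ x → bernMass p x * g (n ⊙ x))
      -- Writing `x` as `n ⊙ (n ⊙ x)` makes the whole summand a function of `n ⊙ x`, so that `∑-⊙`
      -- applies.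
      ≈⟨ ∑-cong {k} (λ x → *-congʳ (reflexive (≡.cong (bernMass p) (⊙-involutive n x)))) ⟨
    ∑ (λ x → bernMass p (n ⊙ (n ⊙ x)) * g (n ⊙ x))
      ≈⟨ ∑-⊙ n (λ x → bernMass p (n ⊙ x) * g x) ⟩
    ∑ (λ x → bernMass p (n ⊙ x) * g x)
      ≈⟨ ∑-cong {k} (λ x → *-congʳ (bernMass-flip p x)) ⟩
    ∑ (λ x → bernMass (1# - p) x * g x) ∎
    where
    n : Vec Sign k
    n = replicate k Sign.-

  -- The fair mask.

  2#≉0 : ¬ 2# ≈ 0#
  2#≉0 = 1≤x⇒x≉0 (≤-respˡ-≈ (+-identityʳ 1#) (+-monoʳ-≤ 1# 0≤1))

  0≤2# : 0# ≤ 2#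
  0≤2# = +-nonneg 0≤1 0≤1

  ½ : Carrier
  ½ = 2# ⁻¹

  ½+½≈1 : ½ + ½ ≈ 1#
  ½+½≈1 = begin-equality
    ½ + ½            ≈⟨ +-cong (*-identityˡ ½) (*-identityˡ ½) ⟨
    1# * ½ + 1# * ½  ≈⟨ distribʳ ½ 1# 1# ⟨
    2# * ½           ≈⟨ *-inverseʳ 2#≉0 ⟩
    1#               ∎

  1-½≈½ : 1# - ½ ≈ ½
  1-½≈½ = sym (x+y≈z⇒y≈z-x ½+½≈1)

  0≤½ : 0# ≤ ½
  0≤½ = ⁻¹-nonneg 2#≉0 0≤2#

  half : UnitInterval
  half = ½ , 0≤½ , 0≤y-x⇒x≤y (≤-respʳ-≈ (sym 1-½≈½) 0≤½)

  bernMass-½ : ∀ {k} (x : Vec Sign k) → bernMass ½ x ≈ (2# ^ k) ⁻¹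
  bernMass-½ {k} x = ⁻¹-unique (2^≉0 k) (scaled x)
    where
    step : ∀ {c y z} → c ≈ ½ → z * y ≈ 1# → (2# * z) * (c * y) ≈ 1#
    step {c} {y} {z} c≈½ zy≈1 = begin-equality
      2# * z * (c * y)    ≈⟨ *-congˡ (*-congʳ c≈½) ⟩
      2# * z * (½ * y)    ≈⟨ solve 4 (λ a z h y → a :* z :* (h :* y) := a :* h :* (z :* y))
                               refl 2# z ½ y ⟩
      2# * ½ * (z * y)    ≈⟨ *-cong (*-inverseʳ 2#≉0) zy≈1 ⟩
      1# * 1#             ≈⟨ *-identityˡ 1# ⟩
      1#                  ∎

    scaled : ∀ {k} (x : Vec Sign k) → 2# ^ k * bernMass ½ x ≈ 1#
    scaled []           = *-identityˡ 1#
    scaled (Sign.+ ∷ x) = step refl (scaled x)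
    scaled (Sign.- ∷ x) = step 1-½≈½ (scaled x)

  𝔼-Bern-½ : ∀ {k} g → 𝔼 (Bern half k) g ≈ 𝔼 (Unif k) g
  𝔼-Bern-½ {k} g = ∑-cong {k} λ x → *-congʳ (bernMass-½ x)

  -- For each fixed `a` the vector `a ⊙ b` is uniform, because `∑-⊙` absorbs `a`. The inner
  -- expectation is thus constant in `a`, and averaging over `D` keeps it.
  λ-half : ∀ {k} (S : Subset k) (D : Δ k) → λ[ S ] D half ≈ ρ S
  λ-half {k} S (D , _) = trans (𝔼-cong D uniform) (𝔼-const D (ρ S))
    where
    uniform : ∀ a → 𝔼 (Bern half k) (λ b → indicator (f S (a ⊙ b))) ≈ ρ S
    uniform a = trans (𝔼-Bern-½ (λ b → indicator (f S (a ⊙ b))))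
      (∑-⊙ a (λ b → (2# ^ k) ⁻¹ * indicator (f S b)))

  -- Bounds on `β`, `γ` and `α` for a general `S`.

  0≤ρ : ∀ {k} (S : Subset k) → 0# ≤ ρ S
  0≤ρ {k} S = 𝔼-nonneg (Unif k) (λ b → 0≤indicator (f S b))

  ρ≤β : ∀ {k} (S : Subset k) (D : Δ k) → ρ S ≤ β[ S ] D
  ρ≤β S D = ≤-respˡ-≈ (λ-half S D) (proj₁ (proj₂ (β-sup S D)) half)

  γ≈ : ∀ {k} (S : Subset k) (D : Δ k) → γ[ S ] D ≈ 𝔼 (proj₁ D) (indicator ∘ f S)
  γ≈ {k} S (D , _) = 𝔼-cong D λ a → trans
    (𝔼-Bern-1 k (λ b → indicator (f S (a ⊙ b))))
    (reflexive (≡.cong (indicator ∘ f S) (⊙-identityʳ a)))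

  unlift : ∀ {x y} → [ x ] ≤⁺ [ y ] → x ≤ y
  unlift [ x≤y ] = x≤y

  -- Taking the decision `z?` as an argument lets the conditional in `ratio` reduce by matching;
  -- when `z` vanishes the ratio is `⊤⁺` and the bound is immediate.
  ≤-guarded-/ : ∀ {x y z} (z? : Dec (z ≈ 0#)) → 0# ≤ x → x ≤ y → 0# ≤ z → z ≤ 1# →
                [ x ] ≤⁺ (if does z? then ⊤⁺ else [ y / z ])
  ≤-guarded-/ (yes _)  0≤x x≤y 0≤z z≤1 = [ _ ] ≤⊤⁺
  ≤-guarded-/ (no z≉0) 0≤x x≤y 0≤z z≤1 = [ x≤y⇒x≤y/z 0≤x x≤y z≉0 0≤z z≤1 ]

  guarded-/-≤ : ∀ {y z} (z? : Dec (z ≈ 0#)) → z ≈ 1# →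
                (if does z? then ⊤⁺ else [ y / z ]) ≤⁺ [ y ]
  guarded-/-≤ (yes z≈0) z≈1 = contradiction (trans (sym z≈0) z≈1) 0≉1
  guarded-/-≤ (no _)    z≈1 = [ ≤-respʳ-≈ (x/1≈x _ z≈1) ≤-refl ]

  ρ≤α : ∀ {n} (S : Subset (suc n)) (S≢∅ : Nonempty S) → ρ S ≤ α S S≢∅
  ρ≤α S S≢∅ = unlift (proj₂ (proj₂ (α-inf S S≢∅)) [ ρ S ] ρ≤ratio)
    where
    ρ≤ratio : ∀ P → [ ρ S ] ≤⁺ ratio S P
    ρ≤ratio ((Dₙ , Dᵧ) , _) =
      ≤-guarded-/ (γ[ S ] Dᵧ ≟ 0#) (0≤ρ S) (ρ≤β S Dₙ) (0≤λ S Dᵧ 𝟙) (λ≤1 S Dᵧ 𝟙)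

  -- The infimum is at most the ratio of this one pair, and a denominator equal to 1 leaves only the
  -- numerator.
  α≤β : ∀ {n} (S : Subset (suc n)) (S≢∅ : Nonempty S) (Dₙ Dᵧ : Δ (suc n)) →
        μ Dₙ ≈ μ Dᵧ → γ[ S ] Dᵧ ≈ 1# → α S S≢∅ ≤ β[ S ] Dₙ
  α≤β S S≢∅ Dₙ Dᵧ μ≈ γ≈1 = unlift (≤⁺-trans _≤_ ≤-trans
    (proj₁ (proj₂ (α-inf S S≢∅)) ((Dₙ , Dᵧ) , μ≈)) 
    (guarded-/-≤ (γ[ S ] Dᵧ ≟ 0#) γ≈1))

  -- Binomial coefficients as layer sizes.

  -- The binomial coefficient C(k, w).
  layer : ℕ → ℕ → Carrier
  layer k w = ∑ {k} λ x → indicator (wt x ≡ᵇ w)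

  0≤layer : ∀ k w → 0# ≤ layer k w
  0≤layer k w = ∑-nonneg {k} λ x → 0≤indicator (wt x ≡ᵇ w)

  layer-suc-zero : ∀ k → layer (suc k) 0 ≈ layer k 0
  layer-suc-zero k = trans (+-congʳ (∑-zero {k} λ _ → refl)) (+-identityˡ _)

  -- The absorption identity (w + 1) C(k + 1, w + 1) = (k + 1) C(k, w), by induction on `k`.
  -- Pascal's rule holds by computation, since `∑` splits on the first sign.
  layer-absorption : ∀ k w → suc w · 1# * layer (suc k) (suc w) ≈ suc k · 1# * layer k w
  layer-absorption zero zero =
    *-congˡ (+-identityʳ 1#)
  layer-absorption zero (suc w) =
    trans (*-congˡ (+-identityˡ 0#)) (trans (zeroʳ _) (sym (zeroʳ _)))
  layer-absorption (suc k) zero = begin-equality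
    1 · 1# * (z + layer (suc k) 1)       ≈⟨ distribˡ _ _ _ ⟩
    1 · 1# * z + 1 · 1# * layer (suc k) 1
      ≈⟨ +-cong (*-congʳ (+-identityʳ 1#)) (layer-absorption k 0) ⟩
    1# * z + suc k · 1# * layer k 0
      ≈⟨ +-congˡ (*-congˡ (layer-suc-zero k)) ⟨
    1# * z + suc k · 1# * z              ≈⟨ distribʳ _ _ _ ⟨
    suc (suc k) · 1# * z                 ∎
    where
    z : Carrier
    z = layer (suc k) 0
  layer-absorption (suc k) (suc w) = begin-equality
    suc (suc w) · 1# * (y + layer (suc k) (suc (suc w)))
      ≈⟨ solve 3 (λ a b c → a :* (b :+ c) := a :* b :+ a :* c) refl _ _ _ ⟩
    (1# + suc w · 1#) * y + suc (suc w) · 1# * layer (suc k) (suc (suc w))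
      -- One copy of `y` is set aside; the induction hypothesis for `w` then handles the remaining
      -- `suc w` copies.
      ≈⟨ +-cong (distribʳ _ _ _) (layer-absorption k (suc w)) ⟩
    1# * y + suc w · 1# * y + suc k · 1# * layer k (suc w)
      ≈⟨ +-congʳ (+-congˡ (layer-absorption k w)) ⟩
    1# * y + suc k · 1# * layer k w + suc k · 1# * layer k (suc w)
      ≈⟨ +-assoc _ _ _ ⟩
    1# * y + (suc k · 1# * layer k w + suc k · 1# * layer k (suc w))
      -- Pascal's rule: `y` unfolds to `layer k w + layer k (suc w)`.
      ≈⟨ +-congˡ (distribˡ _ _ _) ⟨
    1# * y + suc k · 1# * y
      ≈⟨ distribʳ _ _ _ ⟨
    suc (suc k) · 1# * y ∎
    where
    y : Carrier
    y = layer (suc k) (suc w)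

  1≤layer : ∀ {k w} → w ℕ.≤ k → 1# ≤ layer k w
  1≤layer {k} {w} w≤k with ofWeight {k} w w≤k
  ... | x , eq = ≤-respˡ-≈ (reflexive (≡.cong indicator (dec-true (wt x ℕ.≟ w) eq)))
    (term≤∑ (λ y → 0≤indicator (wt y ≡ᵇ w)) x)

  -- The binomial probability: the Bernoulli mass is constant on a layer by `bernMass-wt`.
  𝔼-Bern-layer : ∀ {k} p w → 𝔼 (Bern p k) (λ x → indicator (wt x ≡ᵇ w))
                 ≈ proj₁ p ^ w * (1# - proj₁ p) ^ (k ℕ.∸ w) * layer k w
  𝔼-Bern-layer {k} (p , _) w = trans (∑-cong {k} pointwise)
    (∑-*ˡ {k} _ (λ x → indicator (wt x ≡ᵇ w)))
    where
    pointwise : ∀ x → bernMass p x * indicator (wt x ≡ᵇ w)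
                ≈ p ^ w * (1# - p) ^ (k ℕ.∸ w) * indicator (wt x ≡ᵇ w)
    pointwise x with wt x ℕ.≟ w
    ... | yes eq rewrite ≡.sym eq = *-congʳ (bernMass-wt p x)
    ... | no ≢ rewrite dec-false (wt x ℕ.≟ w) ≢ = trans (zeroʳ _) (sym (zeroʳ _))

  -- The uniform distribution on a layer and mixtures of the two constant vectors.

  μ-split : ∀ {n} (D : Δ (suc n)) → let D′ = proj₁ D in
            μ D ≈ ∑ (λ x → mass D′ (Sign.+ ∷ x)) - ∑ (λ x → mass D′ (Sign.- ∷ x))
  μ-split {n} (D , _) = +-cong
    (∑-cong λ x → *-identityʳ (mass D (Sign.+ ∷ x)))
    (begin-equality
      ∑ (λ x → mass D (Sign.- ∷ x) * - 1#)  ≈⟨ ∑-cong {n} (λ x → *-comm _ (- 1#)) ⟩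
      ∑ (λ x → - 1# * mass D (Sign.- ∷ x))  ≈⟨ ∑-*ˡ {n} (- 1#) _ ⟩
      - 1# * ∑ (λ x → mass D (Sign.- ∷ x))  ≈⟨ -1*x≈-x _ ⟩
      - ∑ (λ x → mass D (Sign.- ∷ x))       ∎)

  uniformOnLayer : ∀ {k w} → w ℕ.≤ k → Δ k
  uniformOnLayer {k} {w} w≤k = record
    { mass        = λ x → layer k w ⁻¹ * indicator (wt x ≡ᵇ w)
    ; mass-nonneg = λ x → *-nonneg (⁻¹-nonneg layer≉0 (0≤layer k w)) (0≤indicator (wt x ≡ᵇ w))
    ; mass-total  = trans (∑-*ˡ {k} (layer k w ⁻¹) _) (*-inverseˡ layer≉0)
    } , λ x y eq → *-congˡ (reflexive (≡.cong (λ v → indicator (v ≡ᵇ w)) eq))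
    where
    layer≉0 : ¬ layer k w ≈ 0#
    layer≉0 = 1≤x⇒x≉0 (1≤layer w≤k)

  -- A vector of weight `suc w` that starts with `+` has weight `w` on the other `n` coordinates;
  -- one that starts with `-` has weight `suc w` there.
  μ-uniformOnLayer : ∀ {n w} (w<1+n : suc w ℕ.≤ suc n) → let N = layer (suc n) (suc w) in
                     μ (uniformOnLayer w<1+n) ≈ N ⁻¹ * layer n w - N ⁻¹ * layer n (suc w)
  μ-uniformOnLayer {n} {w} w<1+n = trans (μ-split (uniformOnLayer w<1+n))
    (+-cong (∑-*ˡ {n} _ _) (-‿cong (∑-*ˡ {n} _ _)))

  indicator-idem : ∀ b → indicator b * indicator b ≈ indicator b
  indicator-idem true  = *-identityˡ 1#
  indicator-idem false = zeroˡ 0#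

  -- `f S` is 1 on the whole support, so multiplying the mass by its indicator changes nothing.
  γ-uniformOnLayer : ∀ {k w} (S : Subset k) (w≤k : w ℕ.≤ k) → (∀ x → f S x ≡ (wt x ≡ᵇ w)) →
                     γ[ S ] (uniformOnLayer w≤k) ≈ 1#
  γ-uniformOnLayer {k} {w} S w≤k f≡ = begin-equality
    γ[ S ] U                               ≈⟨ γ≈ S U ⟩
    ∑ (λ x → c * indicator (wt x ≡ᵇ w) * indicator (f S x))
      ≈⟨ ∑-cong {k} (λ x → trans (*-assoc _ _ _) (*-congˡ (trans
           (*-congˡ (reflexive (≡.cong indicator (f≡ x))))
           (indicator-idem (wt x ≡ᵇ w))))) ⟩
    ∑ {k} (λ x → c * indicator (wt x ≡ᵇ w)) ≈⟨ mass-total (proj₁ U) ⟩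
    1#                                     ∎
    where
    U : Δ k
    U = uniformOnLayer w≤k
    c : Carrier
    c = layer k w ⁻¹

  -- The point masses at the two constant vectors are written as `Bern 𝟙` and `Bern 𝟘`, so that
  -- their symmetry comes from `Bern-symmetric`.
  extremes : ∀ k → UnitInterval → Δ k
  extremes k q = mix q (Bern 𝟙 k) (Bern 𝟘 k) ,
    mix-symmetric q (Bern 𝟙 k) (Bern 𝟘 k) (Bern-symmetric 𝟙) (Bern-symmetric 𝟘)

  𝔼-extremes : ∀ {k} (q : UnitInterval) g → 𝔼 (proj₁ (extremes k q)) g ≈
               proj₁ q * g (replicate k Sign.+) + (1# - proj₁ q) * g (replicate k Sign.-)
  𝔼-extremes {k} q g = trans (𝔼-mix q (Bern 𝟙 k) (Bern 𝟘 k) g)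
    (+-cong (*-congˡ (𝔼-Bern-1 k g)) (*-congˡ (𝔼-Bern-0 k g)))

  μ-extremes : ∀ {n} (q : UnitInterval) → μ (extremes (suc n) q) ≈ proj₁ q - (1# - proj₁ q)
  μ-extremes {n} q = trans (𝔼-extremes {suc n} q (sign ∘ head))
    (+-cong (*-identityʳ _) (trans (*-comm _ _) (-1*x≈-x _)))

  -- The all-plus vector leaves the mask unchanged; the all-minus vector negates it, which replaces
  -- `p` by `1# - p`.
  λ-extremes : ∀ {k} (S : Subset k) (q p : UnitInterval) → let g = indicator ∘ f S in
               λ[ S ] (extremes k q) p ≈
               proj₁ q * 𝔼 (Bern p k) g + (1# - proj₁ q) * 𝔼 (Bern (p ᶜ) k) g
  λ-extremes {k} S q p = trans
    (𝔼-extremes {k} q (λ a → 𝔼 (Bern p k) λ b → indicator (f S (a ⊙ b))))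
    (+-cong
      (*-congˡ (𝔼-cong (Bern p k) λ b → reflexive (≡.cong (indicator ∘ f S) (⊙-identityˡ b))))
      (*-congˡ (𝔼-Bern-flip p (indicator ∘ f S))))

  -- The middle layer for k = 2m + 1.

  module _ (m : ℕ) where
    k : ℕ
    k = suc (2 ℕ.* m)

    S : Subset k
    S = middle m

    -- `A` and `B` are the two Pascal summands of `N`. Thus `q` is the probability that a uniform
    -- vector of weight `m + 1` starts with `+`. `κ` is `k` as a field element, and `δ` turns out to
    -- be `1 / k`.
    N A B κ q δ : Carrier
    N = layer k (suc m)
    A = layer (2 ℕ.* m) m
    B = layer (2 ℕ.* m) (suc m)
    κ = suc (2 ℕ.* m) · 1#
    q = N ⁻¹ * A
    δ = (q + q) - 1#

    m<k : suc m ℕ.≤ suc (2 ℕ.* m)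
    m<k = s≤s (ℕ.m≤m+n m (m ℕ.+ 0))

    1≤N : 1# ≤ N
    1≤N = 1≤layer m<k

    N≉0 : ¬ N ≈ 0#
    N≉0 = 1≤x⇒x≉0 1≤N

    0≤N⁻¹ : 0# ≤ N ⁻¹
    0≤N⁻¹ = ⁻¹-nonneg N≉0 (0≤layer k (suc m))

    q+B/N≈1 : q + N ⁻¹ * B ≈ 1#
    q+B/N≈1 = trans (sym (distribˡ (N ⁻¹) A B)) (*-inverseˡ N≉0)

    0≤q : 0# ≤ q
    0≤q = *-nonneg 0≤N⁻¹ (0≤layer (2 ℕ.* m) m)

    0≤1-q : 0# ≤ 1# - q
    0≤1-q = ≤-respʳ-≈ (x+y≈z⇒y≈z-x q+B/N≈1) (*-nonneg 0≤N⁻¹ (0≤layer (2 ℕ.* m) (suc m)))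

    bias : UnitInterval
    bias = q , 0≤q , 0≤y-x⇒x≤y 0≤1-q

    κ≈1+m+m : κ ≈ 1# + (m · 1# + m · 1#)
    κ≈1+m+m = +-congˡ (trans (×-homo-+ 1# m (m ℕ.+ 0))
      (+-congˡ (×-congˡ {1#} (ℕ.+-identityʳ m))))

    -- The absorption identity (m + 1) N = k A, divided by `N`.
    κ*q≈1+m : κ * q ≈ suc m · 1#
    κ*q≈1+m = begin-equality
      κ * (N ⁻¹ * A)            ≈⟨ x*[y*z]≈y*[x*z] κ (N ⁻¹) A ⟩
      N ⁻¹ * (κ * A)            ≈⟨ *-congˡ (layer-absorption (2 ℕ.* m) m) ⟨
      N ⁻¹ * (suc m · 1# * N)   ≈⟨ *-congˡ (*-comm _ N) ⟩
      N ⁻¹ * (N * suc m · 1#)   ≈⟨ *-assoc _ _ _ ⟨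
      N ⁻¹ * N * suc m · 1#     ≈⟨ *-congʳ (*-inverseˡ N≉0) ⟩
      1# * suc m · 1#           ≈⟨ *-identityˡ _ ⟩
      suc m · 1#                ∎
      where
      x*[y*z]≈y*[x*z] : ∀ x y z → x * (y * z) ≈ y * (x * z)
      x*[y*z]≈y*[x*z] = solve 3 (λ x y z → x :* (y :* z) := y :* (x :* z)) refl

    -- Doubling k q = m + 1 gives 2m + 2 = k + 1, which exceeds `κ` by one.
    κ*δ≈1 : κ * δ ≈ 1#
    κ*δ≈1 = begin-equality
      κ * (q + q - 1#)             ≈⟨ x[y-z]≈xy-xz κ (q + q) 1# ⟩
      κ * (q + q) - κ * 1#         ≈⟨ +-cong κ*[q+q]≈κ+1 (-‿cong (*-identityʳ κ)) ⟩
      κ + 1# - κ                   ≈⟨ x+y≈z⇒y≈z-x refl ⟨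
      1#                           ∎
      where
      κ*[q+q]≈κ+1 : κ * (q + q) ≈ κ + 1#
      κ*[q+q]≈κ+1 = begin-equality
        κ * (q + q)                      ≈⟨ distribˡ κ q q ⟩
        κ * q + κ * q                    ≈⟨ +-cong κ*q≈1+m κ*q≈1+m ⟩
        1# + m · 1# + (1# + m · 1#)      ≈⟨ rearrange 1# (m · 1#) ⟩
        1# + (m · 1# + m · 1#) + 1#      ≈⟨ +-congʳ κ≈1+m+m ⟨
        κ + 1#                           ∎
        where
        rearrange : ∀ x y → x + y + (x + y) ≈ x + (y + y) + x
        rearrange = solve 2 (λ x y → x :+ y :+ (x :+ y) := x :+ (y :+ y) :+ x) refl

    κ≉0 : ¬ κ ≈ 0#
    κ≉0 = 1≤x⇒x≉0 (1≤1+n (2 ℕ.* m))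

    0≤δ : 0# ≤ δ
    0≤δ = ≤-respʳ-≈ (sym (⁻¹-unique κ≉0 κ*δ≈1)) (⁻¹-nonneg κ≉0 (·-nonneg k))

    1-q≤q : 1# - q ≤ q
    1-q≤q = begin
      1# - q       ≤⟨ +-monoˡ-≤ (- q) (0≤y-x⇒x≤y 0≤δ) ⟩
      q + q - q    ≈⟨ x+y≈z⇒y≈z-x refl ⟨
      q            ∎

    𝔼-Bern-middle : ∀ p → 𝔼 (Bern p k) (indicator ∘ f S) ≈
                    proj₁ p * (proj₁ p * (1# - proj₁ p)) ^ m * N
    𝔼-Bern-middle P@(p , _) = begin-equality
      𝔼 (Bern P k) (indicator ∘ f S)
        ≈⟨ 𝔼-cong (Bern P k)
             (λ x → reflexive (≡.cong indicator (f-middle m x))) ⟩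
      𝔼 (Bern P k) (λ x → indicator (wt x ≡ᵇ suc m))
        ≈⟨ 𝔼-Bern-layer {k} P (suc m) ⟩
      p * p ^ m * (1# - p) ^ (m ℕ.+ (m ℕ.+ 0) ℕ.∸ m) * N
        -- The remaining exponent k - (m + 1) is exactly `m`.
        ≈⟨ *-congʳ (*-congˡ (^-congʳ (1# - p)
             (≡.trans (ℕ.m+n∸m≡n m (m ℕ.+ 0)) (ℕ.+-identityʳ m)))) ⟩
      p * p ^ m * (1# - p) ^ m * N
        ≈⟨ *-congʳ (*-assoc _ _ _) ⟩
      p * (p ^ m * (1# - p) ^ m) * N
        ≈⟨ *-congʳ (*-congˡ (^-distrib-* p (1# - p) m)) ⟨
      p * (p * (1# - p)) ^ m * N ∎

    -- The uniform case is `p = ½`, which gives `ρ` the same shape as the Bernoulli probabilities it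
    -- is compared with.
    ρ-middle : ρ S ≈ ½ * (½ * ½) ^ m * N
    ρ-middle = begin-equality
      ρ S                          ≈⟨ 𝔼-Bern-½ (indicator ∘ f S) ⟨
      𝔼 (Bern half k) (indicator ∘ f S)
                                   ≈⟨ 𝔼-Bern-middle half ⟩
      ½ * (½ * (1# - ½)) ^ m * N   ≈⟨ *-congʳ (*-congˡ (^-congˡ m (*-congˡ 1-½≈½))) ⟩
      ½ * (½ * ½) ^ m * N          ∎

    λ-extremes≤ : ∀ p → λ[ S ] (extremes k bias) p ≤ (q + q) * ρ S
    λ-extremes≤ P@(p , 0≤p , p≤1) = begin
      λ[ S ] (extremes k bias) P
        ≈⟨ λ-extremes S bias P ⟩
      q * 𝔼 (Bern P k) (indicator ∘ f S)
        + (1# - q) * 𝔼 (Bern (P ᶜ) k) (indicator ∘ f S)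
        ≈⟨ +-cong (*-congˡ (𝔼-Bern-middle P)) (*-congˡ (trans (𝔼-Bern-middle (P ᶜ))
             (*-congʳ (*-congˡ (^-congˡ m (trans (*-congˡ (1-[1-x]≈x p)) (*-comm _ p))))))) ⟩
      q * (p * t * N) + (1# - q) * ((1# - p) * t * N)
        -- The factor `t` is invariant under exchanging `p` and `1# - p`. Raising the weight
        -- `1# - q` to `q` therefore lets the linear factors add up to 1.
        ≤⟨ +-monoʳ-≤ _ (*-monoʳ-≤ (*-nonneg (*-nonneg 0≤1-p 0≤t) 0≤N) 1-q≤q) ⟩
      q * (p * t * N) + q * ((1# - p) * t * N)
        ≈⟨ factor q p (1# - p) t N ⟩
      q * (p + (1# - p)) * t * N
        ≈⟨ *-congʳ (*-congʳ (trans (*-congˡ (y+[x-y]≈x 1# p)) (*-identityʳ q))) ⟩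
      q * t * N
        ≤⟨ *-monoʳ-≤ 0≤N (*-monoˡ-≤ 0≤q (^-monoˡ-≤ m (*-nonneg 0≤p 0≤1-p) (p[1-p]≤h² p ½+½≈1))) ⟩
      q * (½ * ½) ^ m * N
        -- A factor `½ + ½` is inserted: one `½` completes `ρ`, and the doubling passes to `q`.
        ≈⟨ *-congʳ (*-congʳ (trans (*-congˡ ½+½≈1) (*-identityʳ q))) ⟨
      q * (½ + ½) * (½ * ½) ^ m * N
        ≈⟨ double q ½ ((½ * ½) ^ m) N ⟩
      (q + q) * (½ * (½ * ½) ^ m * N)
        ≈⟨ *-congˡ ρ-middle ⟨
      (q + q) * ρ S ∎
      where
      t : Carrier
      t = (p * (1# - p)) ^ m

      0≤1-p : 0# ≤ 1# - p
      0≤1-p = x≤y⇒0≤y-x p≤1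

      0≤t : 0# ≤ t
      0≤t = ^-nonneg m (*-nonneg 0≤p 0≤1-p)

      0≤N : 0# ≤ N
      0≤N = 0≤layer k (suc m)

      factor : ∀ q a b t n → q * (a * t * n) + q * (b * t * n) ≈ q * (a + b) * t * n
      factor = solve 5 (λ q a b t n → q :* (a :* t :* n) :+ q :* (b :* t :* n)
                                   := q :* (a :+ b) :* t :* n) refl

      double : ∀ q h t n → q * (h + h) * t * n ≈ (q + q) * (h * t * n)
      double = solve 4 (λ q h t n → q :* (h :+ h) :* t :* n
                                 := (q :+ q) :* (h :* t :* n)) refl

    -- `ρ S` is `N` divided by the number of sign vectors, and `N` is at least 1.
    ρ≉0 : ¬ ρ S ≈ 0#
    ρ≉0 ρ≈0 = N≉0 (begin-equality
      N                                        ≈⟨ ∑-cong {k} (λ x → reflexive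
                                                    (≡.cong indicator (f-middle m x))) ⟨
      ∑ (indicator ∘ f S)                      ≈⟨ x*x⁻¹*y≈y _ (2^≉0 k) ⟨
      c * (c ⁻¹ * ∑ (indicator ∘ f S))         ≈⟨ *-congˡ (∑-*ˡ {k} (c ⁻¹) (indicator ∘ f S)) ⟨
      c * ρ S                                  ≈⟨ *-congˡ ρ≈0 ⟩
      c * 0#                                   ≈⟨ zeroʳ c ⟩
      0#                                       ∎)
      where
      c : Carrier
      c = 2# ^ k

    α-middle≤ : α S (middle-nonempty m) ≤ (q + q) * ρ S
    α-middle≤ = ≤-trans
      (α≤β S (middle-nonempty m) Dₙ (uniformOnLayer m<k) μ≈
        (γ-uniformOnLayer S m<k (f-middle m)))
      (proj₂ (proj₂ (β-sup S Dₙ)) ((q + q) * ρ S) λ-extremes≤)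
      where
      Dₙ : Δ k
      Dₙ = extremes k bias

      μ≈ : μ Dₙ ≈ μ (uniformOnLayer m<k)
      μ≈ = begin-equality
        μ Dₙ                          ≈⟨ μ-extremes {2 ℕ.* m} bias ⟩
        -- The choice of `q` matches the means: `1# - q` is `B / N`, the mass of the vectors in the
        -- layer that start with `-`.
        q - (1# - q)                  ≈⟨ +-congˡ (-‿cong (x+y≈z⇒y≈z-x q+B/N≈1)) ⟨
        q - N ⁻¹ * B                  ≈⟨ μ-uniformOnLayer m<k ⟨
        μ (uniformOnLayer m<k)        ∎

    ∣α/ρ-1∣≤δ : ∣ α S (middle-nonempty m) / ρ S - 1# ∣ ≤ δ
    ∣α/ρ-1∣≤δ = ∣x/y-1∣≤c-1 {α S (middle-nonempty m)} {ρ S} {q + q}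
      ρ≉0 (0≤ρ S) (ρ≤α S (middle-nonempty m)) α-middle≤

  -- Passage to the limit.

  -- If `ε ≤ δ`, then k ε ≤ k δ = 1, whereas k ≥ n + 1 ≥ 1/ε + 1 gives k ε ≥ 1 + ε.
  ε≰δ : ∀ {ε n} → 0# < ε → ε ⁻¹ ≤ n · 1# → ∀ m → suc n ℕ.≤ suc (2 ℕ.* m) → ¬ ε ≤ δ m
  ε≰δ {ε} {n} (0≤ε , 0≉ε) ε⁻¹≤n m n<k ε≤δ = 0≉ε (≤-antisym 0≤ε ε≤0)
    where
    1+ε≤1 : 1# + ε ≤ 1#
    1+ε≤1 = begin
      1# + ε                 ≈⟨ +-comm 1# ε ⟩
      ε + 1#                 ≈⟨ +-cong (*-identityʳ ε) (*-inverseʳ (0≉ε ∘ sym)) ⟨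
      ε * 1# + ε * ε ⁻¹      ≈⟨ distribˡ ε 1# (ε ⁻¹) ⟨
      ε * (1# + ε ⁻¹)        ≤⟨ *-monoˡ-≤ 0≤ε (+-monoʳ-≤ 1# ε⁻¹≤n) ⟩
      ε * suc n · 1#         ≤⟨ *-monoˡ-≤ 0≤ε (·-monoˡ-≤ n<k) ⟩
      ε * κ m                ≤⟨ *-monoʳ-≤ (·-nonneg (suc (2 ℕ.* m))) ε≤δ ⟩
      δ m * κ m              ≈⟨ *-comm (δ m) (κ m) ⟩
      κ m * δ m              ≈⟨ κ*δ≈1 m ⟩
      1#                     ∎

    ε≤0 : ε ≤ 0#
    ε≤0 = begin
      ε               ≈⟨ x+y≈z⇒y≈z-x refl ⟩
      1# + ε - 1#     ≤⟨ +-monoˡ-≤ (- 1#) 1+ε≤1 ⟩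
      1# - 1#         ≈⟨ -‿inverseʳ 1# ⟩
      0#              ∎

theorem1p6 : ∀ {ℓ} (R : CompleteOrderedField ℓ) →
    let open CompleteOrderedField R
        open Sketching R
    in (λ m → α (middle m) (middle-nonempty m) / ρ (middle m)) ⟶ 1# along-odd
-- Here `n` is at least `ε ⁻¹`; the extra one in the threshold makes the bound 1/k < ε strict.
theorem1p6 R ε 0<ε = suc n , λ m n<k →
  ≤∧≱⇒< {∣ α (middle m) (middle-nonempty m) / ρ (middle m) - 1# ∣} {δ m} {ε}
    (∣α/ρ-1∣≤δ m) (ε≰δ 0<ε ε⁻¹≤n m n<k)
  where
  open CompleteOrderedField R
  open Sketching R
  open OrderedFieldLemmas R
  open SketchingLemmas R

  n : ℕ
  n = proj₁ (archimedean (ε ⁻¹))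

  ε⁻¹≤n : ε ⁻¹ ≤ n · 1#
  ε⁻¹≤n = proj₂ (archimedean (ε ⁻¹))
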